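{- There is a universal constant $c>0$ such that the following holds. For all integers $q,n,r,t$ satisfying $q\geq 2$, $n,r\geq 1$ and $1\leq t\leq nr$, there exists a $t$-$(q,n,r,\lambda)$ ordered orthogonal array $Y$ (for some positive integer $\lambda$) whose number of rows satisfies \[ |Y|\leq \left(\frac{cq(n+t)}{t}\right)^{ct}. \]
   Context: A $t$-$(q,n,r,\lambda)$ ordered orthogonal array is an $M\times nr$ array with entries from a set of $q$ symbols, where the $nr$ columns are divided into $n$ blocks each consisting of $r$ ordered columns, such that for every $n$-tuple $(t_1,\dots,t_n)$ of integers with $0\le t_i\le r$ and $t_1+\dots+t_n=t$, the $M\times t$ subarray consisting of the first $t_1$ columns of the first block, the first $t_2$ columns of the second block, and so on, contains every $t$-tuple of symbols exactly $\lambda$ times as a row. Here $|Y|=M=\lambda q^t$ denotes the number of rows (the size) of the array. -}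

module Defs where

open import Data.Nat using (ℕ; zero; suc; _+_; _*_; _^_; _≤_)
open import Data.Bool using (Bool; true; false)
open import Data.Fin using (Fin; zero; suc; inject≤)
open import Data.Fin.Properties using (all?; _≟_)
open import Relation.Nullary.Decidable using (⌊_⌋)
open import Relation.Binary.PropositionalEquality using (_≡_)

∑ : ∀ {n} → (Fin n → ℕ) → ℕ
∑ {zero}  f = 0
∑ {suc n} f = f zero + ∑ (λ i → f (suc i))

count : ∀ {M} → (Fin M → Bool) → ℕ
count {zero}  p = 0
count {suc M} p with p zero
... | true  = suc (count (λ i → p (suc i)))
... | false = count (λ i → p (suc i))

-- An M × nr array over q symbols: row m, block i (of n), column j (of r) in the block.
Array : ℕ → ℕ → ℕ → ℕ → Set
Array M n r q = Fin M → Fin n → Fin r → Fin q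

rowMatches : ∀ {M n r q} (Y : Array M n r q) (ts : Fin n → ℕ)
             (le : ∀ i → ts i ≤ r) (s : (i : Fin n) → Fin (ts i) → Fin q) →
             Fin M → Bool
rowMatches Y ts le s m =
  ⌊ all? (λ i → all? (λ j → Y m i (inject≤ j (le i)) ≟ s i j)) ⌋

IsOOA : (t q n r lam M : ℕ) → Array M n r q → Set
IsOOA t q n r lam M Y =
  (ts : Fin n → ℕ) (le : ∀ i → ts i ≤ r) → ∑ ts ≡ t →
  (s : (i : Fin n) → Fin (ts i) → Fin q) →
  count (rowMatches Y ts le s) ≡ lam

{-# OPTIONS --safe #-}
module Submission where

-- Call a prescription of initial segments of the blocks, of total length at most t, a test.
-- Fix a row y.  Telescoping in every block writes any row b, as far as tests are concerned, as a
-- signed combination J of N rows, each obtained from y by overwriting initial segments of total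
-- length at most t.  Now take L = N³ rows y₁, …, y_L and all N perturbations of each.  By the
-- second moment method the y's can be chosen such that this multiset B is so close to uniform on
-- all tests that its error, spread evenly over the y's and transported by J to the perturbations
-- of each y, can be subtracted without making any weight negative.  The weights have the small
-- common denominator L qᵗ, so clearing it gives an exact array with λ = N⁷, where
-- N ≤ (8 q (n + t) / t)ᵗ.

open import Defs
open import Data.Nat using (ℕ; zero; suc; _+_; _*_; _^_; _∸_; _≤_; _<_; z≤n; s≤s; _!; >-nonZero)
import Data.Nat.Properties as ℕ
open import Data.Nat.Tactic.RingSolver using () renaming (solve-∀ to ℕ-solve-∀)
open import Data.Integer using (ℤ; +_; -[1+_]; ∣_∣; 0ℤ; 1ℤ; +≤+; -≤+)
  renaming (_+_ to _+ℤ_; _*_ to _*ℤ_; _-_ to _-ℤ_; -_ to -ℤ_; _≤_ to _≤ℤ_)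
import Data.Integer as ℤ
import Data.Integer.Properties as ℤ
open import Data.Integer.Tactic.RingSolver using (solve-∀)
open import Data.Bool using (Bool; true; false)
open import Data.Fin using (Fin; zero; suc; toℕ; inject≤)
open import Data.Fin.Properties using (all?; _≟_; toℕ-inject≤)
open import Data.List
  using (List; []; _∷_; _++_; map; length; replicate; allFin; cartesianProductWith; concatMap; lookup)
import Data.List as List
open import Data.List.Properties using (length-++; length-map; length-tabulate)
open import Data.List.Membership.Propositional using (_∈_)
open import Data.List.Relation.Unary.Any using (here; there)
open import Data.List.Relation.Unary.All as All using (All; []; _∷_)
import Data.List.Relation.Unary.All.Properties as All
open import Data.Vec using (Vec; []; _∷_)
import Data.Vec as Vec
import Data.Vec.Relation.Unary.All as VecAll
open VecAll using ([]; _∷_)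
open import Data.Product using (Σ; _×_; ∃; _,_; proj₁; proj₂)
open import Data.Sum using (_⊎_; inj₁; inj₂)
open import Data.Empty using (⊥-elim)
open import Function using (_∘_)
open import Relation.Nullary using (¬_; Dec; yes; no)
open import Relation.Nullary.Decidable using (⌊_⌋)
open import Relation.Binary.PropositionalEquality
  using (_≡_; refl; sym; trans; cong; cong₂; subst; module ≡-Reasoning)

private variable
  A B C : Set

-- Sums over lists

∑ᴸ : List A → (A → ℤ) → ℤ
∑ᴸ []       f = 0ℤ
∑ᴸ (x ∷ xs) f = f x +ℤ ∑ᴸ xs f

∑-cong-∈ : ∀ (xs : List A) {f g} → (∀ x → x ∈ xs → f x ≡ g x) → ∑ᴸ xs f ≡ ∑ᴸ xs g
∑-cong-∈ []       eq = refl
∑-cong-∈ (x ∷ xs) eq = cong₂ _+ℤ_ (eq x (here refl)) (∑-cong-∈ xs (λ y y∈ → eq y (there y∈)))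

∑-cong : ∀ (xs : List A) {f g} → (∀ x → f x ≡ g x) → ∑ᴸ xs f ≡ ∑ᴸ xs g
∑-cong xs eq = ∑-cong-∈ xs (λ x _ → eq x)

∑-++ : ∀ (xs ys : List A) f → ∑ᴸ (xs ++ ys) f ≡ ∑ᴸ xs f +ℤ ∑ᴸ ys f
∑-++ []       ys f = sym (ℤ.+-identityˡ _)
∑-++ (x ∷ xs) ys f = trans (cong (f x +ℤ_) (∑-++ xs ys f)) (sym (ℤ.+-assoc (f x) _ _))

∑-map : ∀ (h : A → B) xs f → ∑ᴸ (map h xs) f ≡ ∑ᴸ xs (f ∘ h)
∑-map h []       f = refl
∑-map h (x ∷ xs) f = cong (f (h x) +ℤ_) (∑-map h xs f)

∑-product : ∀ (h : A → B → C) xs ys f →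
  ∑ᴸ (cartesianProductWith h xs ys) f ≡ ∑ᴸ xs (λ x → ∑ᴸ ys (λ y → f (h x y)))
∑-product h []       ys f = refl
∑-product h (x ∷ xs) ys f = trans (∑-++ (map (h x) ys) _ f)
  (cong₂ _+ℤ_ (∑-map (h x) ys f) (∑-product h xs ys f))

∑-+ : ∀ (xs : List A) f g → ∑ᴸ xs (λ x → f x +ℤ g x) ≡ ∑ᴸ xs f +ℤ ∑ᴸ xs g
∑-+ []       f g = refl
∑-+ (x ∷ xs) f g = trans (cong (f x +ℤ g x +ℤ_) (∑-+ xs f g)) (interchange (f x) (g x) _ _)
  where
  interchange : ∀ a b c d → (a +ℤ b) +ℤ (c +ℤ d) ≡ (a +ℤ c) +ℤ (b +ℤ d)
  interchange = solve-∀

∑-*ˡ : ∀ (xs : List A) c f → ∑ᴸ xs (λ x → c *ℤ f x) ≡ c *ℤ ∑ᴸ xs f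
∑-*ˡ []       c f = sym (ℤ.*-zeroʳ c)
∑-*ˡ (x ∷ xs) c f = trans (cong (c *ℤ f x +ℤ_) (∑-*ˡ xs c f)) (sym (ℤ.*-distribˡ-+ c (f x) _))

∑-neg : ∀ (xs : List A) f → ∑ᴸ xs (λ x → -ℤ f x) ≡ -ℤ ∑ᴸ xs f
∑-neg []       f = refl
∑-neg (x ∷ xs) f = trans (cong (-ℤ f x +ℤ_) (∑-neg xs f)) (sym (ℤ.neg-distrib-+ (f x) _))

∑-- : ∀ (xs : List A) f g → ∑ᴸ xs (λ x → f x -ℤ g x) ≡ ∑ᴸ xs f -ℤ ∑ᴸ xs g
∑-- xs f g = trans (∑-+ xs f (λ x → -ℤ g x)) (cong (∑ᴸ xs f +ℤ_) (∑-neg xs g))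

∑-const : ∀ (xs : List A) c → ∑ᴸ xs (λ _ → c) ≡ + length xs *ℤ c
∑-const []       c = refl
∑-const (x ∷ xs) c = trans (cong (c +ℤ_) (∑-const xs c)) (sym (ℤ.suc-* (+ length xs) c))

∑-swap : ∀ (xs : List A) (ys : List B) (f : A → B → ℤ) →
  ∑ᴸ xs (λ x → ∑ᴸ ys (f x)) ≡ ∑ᴸ ys (λ y → ∑ᴸ xs (λ x → f x y))
∑-swap []       ys f = sym (trans (∑-const ys 0ℤ) (ℤ.*-zeroʳ (+ length ys)))
∑-swap (x ∷ xs) ys f = trans (cong (∑ᴸ ys (f x) +ℤ_) (∑-swap xs ys f)) (sym (∑-+ ys (f x) _))

∑-mono-∈ : ∀ (xs : List A) {f g} → (∀ x → x ∈ xs → f x ≤ℤ g x) → ∑ᴸ xs f ≤ℤ ∑ᴸ xs g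
∑-mono-∈ []       le = ℤ.≤-refl
∑-mono-∈ (x ∷ xs) le = ℤ.+-mono-≤ (le x (here refl)) (∑-mono-∈ xs (λ y y∈ → le y (there y∈)))

term≤∑ : ∀ {xs : List A} {f} → (∀ x → 0ℤ ≤ℤ f x) → ∀ {x} → x ∈ xs → f x ≤ℤ ∑ᴸ xs f
term≤∑ {xs = y ∷ xs} {f} pos (here refl) =
  ℤ.≤-trans (ℤ.≤-reflexive (sym (ℤ.+-identityʳ (f y)))) (ℤ.+-monoʳ-≤ (f y)
    (ℤ.≤-trans (ℤ.≤-reflexive (sym ∑0)) (∑-mono-∈ xs {λ _ → 0ℤ} {f} (λ x _ → pos x))))
  where
  ∑0 : ∑ᴸ xs (λ _ → 0ℤ) ≡ 0ℤ
  ∑0 = trans (∑-const xs 0ℤ) (ℤ.*-zeroʳ (+ length xs))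
term≤∑ {xs = y ∷ xs} {f} pos {x} (there x∈) =
  ℤ.≤-trans (ℤ.≤-reflexive (sym (ℤ.+-identityˡ (f x)))) (ℤ.+-mono-≤ (pos y) (term≤∑ {f = f} pos x∈))

∣∑∣≤ : ∀ (xs : List A) f {c} → (∀ x → x ∈ xs → ∣ f x ∣ ≤ c) → ∣ ∑ᴸ xs f ∣ ≤ length xs * c
∣∑∣≤ []       f le = z≤n
∣∑∣≤ (x ∷ xs) f le = ℕ.≤-trans (ℤ.∣i+j∣≤∣i∣+∣j∣ (f x) _)
  (ℕ.+-mono-≤ (le x (here refl)) (∣∑∣≤ xs f (λ y y∈ → le y (there y∈))))

∑≤0⇒∃≤0 : ∀ (xs : List A) f → 0 < length xs → ∑ᴸ xs f ≤ℤ 0ℤ → ∃ λ x → f x ≤ℤ 0ℤ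
∑≤0⇒∃≤0 {A} (x₀ ∷ xs₀) f _ = go x₀ xs₀
  where
  go : ∀ x (xs : List A) → f x +ℤ ∑ᴸ xs f ≤ℤ 0ℤ → ∃ λ x → f x ≤ℤ 0ℤ
  go x []       le = x , ℤ.≤-trans (ℤ.≤-reflexive (sym (ℤ.+-identityʳ (f x)))) le
  go x (y ∷ xs) le with f x ℤ.≤? 0ℤ
  ... | yes p = x , p
  ... | no ¬p = go y xs (ℤ.≤-trans (ℤ.≤-reflexive (sym (ℤ.+-identityˡ (∑ᴸ (y ∷ xs) f))))
    (ℤ.≤-trans (ℤ.+-monoˡ-≤ (∑ᴸ (y ∷ xs) f) (ℤ.<⇒≤ (ℤ.≰⇒> ¬p))) le))

length-product : ∀ (h : A → B → C) xs ys →
  length (cartesianProductWith h xs ys) ≡ length xs * length ys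
length-product h []       ys = refl
length-product h (x ∷ xs) ys = trans (length-++ (map (h x) ys))
  (cong₂ _+_ (length-map (h x) ys) (length-product h xs ys))

∑-tabulate : ∀ {n} (h : Fin n → A) f → ∑ᴸ (List.tabulate h) f ≡ ∑ᴸ (allFin n) (f ∘ h)
∑-tabulate {n = zero}  h f = refl
∑-tabulate {n = suc n} h f = cong (f (h zero) +ℤ_)
  (trans (∑-tabulate (h ∘ suc) f) (sym (∑-tabulate suc (f ∘ h))))

-- Kronecker delta.

δ : ∀ {n} → Fin n → Fin n → ℤ
δ zero    zero    = 1ℤ
δ zero    (suc b) = 0ℤ
δ (suc a) zero    = 0ℤ
δ (suc a) (suc b) = δ a b

δ-cases : ∀ {n} (a b : Fin n) → (δ a b ≡ 1ℤ × b ≡ a) ⊎ (δ a b ≡ 0ℤ × ¬ b ≡ a)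
δ-cases zero    zero    = inj₁ (refl , refl)
δ-cases zero    (suc b) = inj₂ (refl , λ ())
δ-cases (suc a) zero    = inj₂ (refl , λ ())
δ-cases (suc a) (suc b) with δ-cases a b
... | inj₁ (eq , refl) = inj₁ (eq , refl)
... | inj₂ (eq , ne)   = inj₂ (eq , λ { refl → ne refl })

δ-sym : ∀ {n} (a b : Fin n) → δ a b ≡ δ b a
δ-sym zero    zero    = refl
δ-sym zero    (suc b) = refl
δ-sym (suc a) zero    = refl
δ-sym (suc a) (suc b) = δ-sym a b

∑-δ : ∀ {n} (x : Fin n) (g : Fin n → ℤ) → ∑ᴸ (allFin n) (λ a → δ a x *ℤ g a) ≡ g x
∑-δ {suc n} zero g = trans
  (cong₂ _+ℤ_ (ℤ.*-identityˡ (g zero))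
    (trans (∑-tabulate {n = n} suc _) (trans (∑-const (allFin n) 0ℤ) (ℤ.*-zeroʳ (+ length (allFin n))))))
  (ℤ.+-identityʳ _)
∑-δ {suc n} (suc x) g = trans (ℤ.+-identityˡ _)
  (trans (∑-tabulate {n = n} suc _) (∑-δ x (g ∘ suc)))

-- Squares and the second moment method.

square : ∀ (i : ℤ) → i *ℤ i ≡ + (∣ i ∣ * ∣ i ∣)
square i = trans (sym (ℤ.0≤i⇒+∣i∣≡i (nonNeg i))) (cong +_ (ℤ.abs-* i i))
  where
  nonNeg : ∀ i → 0ℤ ≤ℤ i *ℤ i
  nonNeg (+ zero)    = +≤+ z≤n
  nonNeg (+ suc n)   = +≤+ z≤n
  nonNeg -[1+ n ]    = +≤+ z≤n

-- The method of conditional expectations: choosing each new sample so that the cross term is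
-- nonpositive, the sum of squared deviations grows at most linearly.
small-deviations : (Ω : List A) (K : List B) (H : B → A → ℤ) (c : ℕ) → 0 < length Ω →
  (∀ τ → τ ∈ K → ∑ᴸ Ω (H τ) ≡ 0ℤ) → (∀ τ → τ ∈ K → ∀ y → ∣ H τ y ∣ ≤ c) →
  ∀ L → ∃ λ ys → length ys ≡ L ×
    ∑ᴸ K (λ τ → ∑ᴸ ys (H τ) *ℤ ∑ᴸ ys (H τ)) ≤ℤ + (L * (length K * (c * c)))
small-deviations Ω K H c Ω≢[] mean bound zero =
  [] , refl , ℤ.≤-reflexive (trans (∑-const K 0ℤ) (ℤ.*-zeroʳ (+ length K)))
small-deviations Ω K H c Ω≢[] mean bound (suc L)
  with small-deviations Ω K H c Ω≢[] mean bound L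
... | ys , refl , le with ∑≤0⇒∃≤0 Ω cross Ω≢[] (ℤ.≤-reflexive cross-mean)
  where
  E = λ τ → ∑ᴸ ys (H τ)
  cross : _ → ℤ
  cross y = ∑ᴸ K (λ τ → (+ 2 *ℤ E τ) *ℤ H τ y)
  -- `E τ` does not depend on the new sample and `H τ` has mean zero, so the cross terms average to
  -- zero and some sample makes them nonpositive.
  cross-mean : ∑ᴸ Ω cross ≡ 0ℤ
  cross-mean = begin
    ∑ᴸ Ω cross                                          ≡⟨ ∑-swap Ω K (λ y τ → (+ 2 *ℤ E τ) *ℤ H τ y) ⟩
    ∑ᴸ K (λ τ → ∑ᴸ Ω (λ y → (+ 2 *ℤ E τ) *ℤ H τ y))
      ≡⟨ ∑-cong-∈ K (λ τ τ∈ → trans (∑-*ˡ Ω (+ 2 *ℤ E τ) (H τ))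
           (trans (cong ((+ 2 *ℤ E τ) *ℤ_) (mean τ τ∈)) (ℤ.*-zeroʳ (+ 2 *ℤ E τ)))) ⟩
    ∑ᴸ K (λ _ → 0ℤ)                                     ≡⟨ ∑-const K 0ℤ ⟩
    + length K *ℤ 0ℤ                                    ≡⟨ ℤ.*-zeroʳ (+ length K) ⟩
    0ℤ ∎
    where open ≡-Reasoning
... | y , cross≤0 = y ∷ ys , refl , (begin
    ∑ᴸ K (λ τ → (H τ y +ℤ E τ) *ℤ (H τ y +ℤ E τ))
      ≡⟨ ∑-cong K (λ τ → expand (H τ y) (E τ)) ⟩
    ∑ᴸ K (λ τ → H τ y *ℤ H τ y +ℤ ((+ 2 *ℤ E τ) *ℤ H τ y +ℤ E τ *ℤ E τ))
      ≡⟨ trans (∑-+ K (λ τ → H τ y *ℤ H τ y) _) (cong (∑ᴸ K (λ τ → H τ y *ℤ H τ y) +ℤ_) (∑-+ K (λ τ → (+ 2 *ℤ E τ) *ℤ H τ y) _)) ⟩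
    ∑ᴸ K (λ τ → H τ y *ℤ H τ y) +ℤ
      (∑ᴸ K (λ τ → (+ 2 *ℤ E τ) *ℤ H τ y) +ℤ ∑ᴸ K (λ τ → E τ *ℤ E τ))
      ≤⟨ ℤ.+-mono-≤ (∑-mono-∈ K (λ τ τ∈ → sq≤ {H τ y} (bound τ τ∈ y))) (ℤ.+-mono-≤ cross≤0 le) ⟩
    ∑ᴸ K (λ _ → + (c * c)) +ℤ (0ℤ +ℤ + (length ys * (length K * (c * c))))
      ≡⟨ cong₂ _+ℤ_ (trans (∑-const K (+ (c * c))) (sym (ℤ.pos-* (length K) (c * c)))) (ℤ.+-identityˡ (+ (length ys * (length K * (c * c))))) ⟩
    + (suc (length ys) * (length K * (c * c))) ∎)
  where
  open ℤ.≤-Reasoning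
  E = λ τ → ∑ᴸ ys (H τ)
  expand : ∀ h e → (h +ℤ e) *ℤ (h +ℤ e) ≡ h *ℤ h +ℤ ((+ 2 *ℤ e) *ℤ h +ℤ e *ℤ e)
  expand = solve-∀
  sq≤ : ∀ {i} → ∣ i ∣ ≤ c → i *ℤ i ≤ℤ + (c * c)
  sq≤ {i} le = ℤ.≤-trans (ℤ.≤-reflexive (square i)) (+≤+ (ℕ.*-mono-≤ {∣ i ∣} {c} le le))

sq-cancel-≤ : ∀ {a b} → a * a ≤ b * b → a ≤ b
sq-cancel-≤ {a} {b} le with a ℕ.≤? b
... | yes p = p
... | no ¬p = ⊥-elim (ℕ.<⇒≱ (ℕ.*-mono-< (ℕ.≰⇒> ¬p) (ℕ.≰⇒> ¬p)) le)

∑-concatMap : ∀ (f : A → List B) xs g → ∑ᴸ (concatMap f xs) g ≡ ∑ᴸ xs (λ x → ∑ᴸ (f x) g)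
∑-concatMap f []       g = refl
∑-concatMap f (x ∷ xs) g = trans (∑-++ (f x) _ g) (cong (∑ᴸ (f x) g +ℤ_) (∑-concatMap f xs g))

∑-replicate : ∀ k (x : A) g → ∑ᴸ (replicate k x) g ≡ + k *ℤ g x
∑-replicate zero    x g = refl
∑-replicate (suc k) x g = trans (cong (g x +ℤ_) (∑-replicate k x g)) (sym (ℤ.suc-* (+ k) (g x)))

i≤∣i∣ : ∀ i → i ≤ℤ + ∣ i ∣
i≤∣i∣ (+ n)    = ℤ.≤-refl
i≤∣i∣ -[1+ n ] = -≤+

-- Size estimates

m^k*m!≤[m+k]! : ∀ m k → m ^ k * m ! ≤ (m + k) !
m^k*m!≤[m+k]! m zero    = ℕ.≤-reflexive (trans (ℕ.*-identityˡ (m !)) (cong _! (sym (ℕ.+-identityʳ m))))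
m^k*m!≤[m+k]! m (suc k) = begin
  m * m ^ k * m !         ≡⟨ ℕ.*-assoc m (m ^ k) (m !) ⟩
  m * (m ^ k * m !)       ≤⟨ ℕ.*-mono-≤ (ℕ.≤-trans (ℕ.m≤m+n m k) (ℕ.n≤1+n (m + k))) (m^k*m!≤[m+k]! m k) ⟩
  suc (m + k) * (m + k) ! ≡⟨ cong _! (sym (ℕ.+-suc m k)) ⟩
  (m + suc k) ! ∎
  where open ℕ.≤-Reasoning

-- The bound `2 ^ (m + k)` on a binomial coefficient, with the denominators cleared.
[m+k]!≤2^[m+k]*m!*k! : ∀ m k → (m + k) ! ≤ 2 ^ (m + k) * (m ! * k !)
[m+k]!≤2^[m+k]*m!*k! zero    k = ℕ.≤-trans (ℕ.≤-reflexive (sym (ℕ.*-identityˡ (k !))))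
  (ℕ.*-mono-≤ (ℕ.m^n>0 2 k) (ℕ.≤-reflexive (sym (ℕ.*-identityˡ (k !)))))
[m+k]!≤2^[m+k]*m!*k! (suc m) zero rewrite ℕ.+-identityʳ m =
  ℕ.≤-trans (ℕ.≤-reflexive (sym (ℕ.*-identityˡ (suc m !))))
    (ℕ.*-mono-≤ (ℕ.m^n>0 2 (suc m)) (ℕ.≤-reflexive (sym (ℕ.*-identityʳ (suc m !)))))
[m+k]!≤2^[m+k]*m!*k! (suc m) (suc k) = begin
  suc (m + suc k) * (m + suc k) !
    -- Pascal's rule in factorial form: the leading factor is split as `suc m + suc k`.
    ≡⟨ split m k ((m + suc k) !) ⟩
  suc m * (m + suc k) ! + suc k * (m + suc k) !
    ≡⟨ cong (λ x → suc m * (m + suc k) ! + suc k * x !) (ℕ.+-suc m k) ⟩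
  suc m * (m + suc k) ! + suc k * (suc m + k) !
    ≤⟨ ℕ.+-mono-≤ (ℕ.*-monoʳ-≤ (suc m) ([m+k]!≤2^[m+k]*m!*k! m (suc k)))
         (ℕ.*-monoʳ-≤ (suc k) ([m+k]!≤2^[m+k]*m!*k! (suc m) k)) ⟩
  suc m * (2 ^ (m + suc k) * (m ! * suc k !)) + suc k * (2 ^ (suc m + k) * (suc m ! * k !))
    ≡⟨ cong (λ x → suc m * (2 ^ (m + suc k) * (m ! * suc k !)) + suc k * (2 ^ x * (suc m ! * k !)))
         (sym (ℕ.+-suc m k)) ⟩
  suc m * (2 ^ (m + suc k) * (m ! * suc k !)) + suc k * (2 ^ (m + suc k) * (suc m ! * k !))
    ≡⟨ collect (suc m) (suc k) (2 ^ (m + suc k)) (m !) (k !) ⟩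
  2 * 2 ^ (m + suc k) * (suc m ! * suc k !) ∎
  where
  open ℕ.≤-Reasoning
  split : ∀ m k x → suc (m + suc k) * x ≡ suc m * x + suc k * x
  split = ℕ-solve-∀
  collect : ∀ a b p x y → a * (p * (x * (b * y))) + b * (p * (a * x * y)) ≡ 2 * p * (a * x * (b * y))
  collect = ℕ-solve-∀

^-distribʳ-* : ∀ a b k → (a * b) ^ k ≡ a ^ k * b ^ k
^-distribʳ-* a b zero    = refl
^-distribʳ-* a b (suc k) = trans (cong (a * b *_) (^-distribʳ-* a b k)) (interchange a b (a ^ k) (b ^ k))
  where
  interchange : ∀ a b c d → a * b * (c * d) ≡ a * c * (b * d)
  interchange = ℕ-solve-∀

-- A weak form of Stirling's bound: `(n + n) !` lies between `n ^ n * n !` and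
-- `4 ^ n * (n ! * n !)`, and one `n !` cancels.
n^n≤4^n*n! : ∀ n → n ^ n ≤ 4 ^ n * n !
n^n≤4^n*n! n = ℕ.*-cancelʳ-≤ (n ^ n) (4 ^ n * n !) (n !) {{n ℕ.!≢0}} (begin
  n ^ n * n !               ≤⟨ m^k*m!≤[m+k]! n n ⟩
  (n + n) !                 ≤⟨ [m+k]!≤2^[m+k]*m!*k! n n ⟩
  2 ^ (n + n) * (n ! * n !) ≡⟨ cong (_* (n ! * n !)) (trans (ℕ.^-distribˡ-+-* 2 n n) (sym (^-distribʳ-* 2 2 n))) ⟩
  4 ^ n * (n ! * n !)       ≡⟨ sym (ℕ.*-assoc (4 ^ n) (n !) (n !)) ⟩
  4 ^ n * n ! * n ! ∎)
  where
  open ℕ.≤-Reasoning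

n!≤n^n : ∀ n → n ! ≤ n ^ n
n!≤n^n zero    = ℕ.≤-refl
n!≤n^n (suc n) = ℕ.*-monoʳ-≤ (suc n) (ℕ.≤-trans (n!≤n^n n) (ℕ.^-monoˡ-≤ n (ℕ.n≤1+n n)))

-- The first two terms of a binomial expansion; they drive the induction that bounds the length of
-- `J`.
bernoulli : ∀ m k → m ^ suc k + suc k * m ^ k ≤ suc m ^ suc k
bernoulli m zero    = ℕ.≤-reflexive (lemma m)
  where
  lemma : ∀ m → m * 1 + 1 * 1 ≡ suc m * 1
  lemma = ℕ-solve-∀
bernoulli m (suc k) = begin
  m * m ^ suc k + suc (suc k) * m ^ suc k
    ≤⟨ ℕ.m≤m+n _ (suc k * m ^ k) ⟩
  m * m ^ suc k + suc (suc k) * (m * m ^ k) + suc k * m ^ k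
    ≡⟨ rearrange m k (m ^ k) ⟩
  suc m * (m ^ suc k + suc k * m ^ k)
    ≤⟨ ℕ.*-monoʳ-≤ (suc m) (bernoulli m k) ⟩
  suc m * suc m ^ suc k ∎
  where
  open ℕ.≤-Reasoning
  rearrange : ∀ m k x → m * (m * x) + suc (suc k) * (m * x) + suc k * x ≡
    suc m * (m * x + suc k * x)
  rearrange = ℕ-solve-∀

-- Indicator values

Holds : Set → ℤ → Set
Holds P x = (x ≡ 1ℤ × P) ⊎ (x ≡ 0ℤ × ¬ P)

-- `S` plays the conjunction but is left arbitrary, so that it can be a statement quantified over
-- `Fin (suc k)` with `P` its instance at `zero` and `R` the remaining ones.
holds-× : ∀ {P R S : Set} {x y} → (P → R → S) → (S → P) → (S → R) →
  Holds P x → Holds R y → Holds S (x *ℤ y)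
holds-× pair fst snd (inj₁ (refl , p)) (inj₁ (refl , r)) = inj₁ (refl , pair p r)
holds-× pair fst snd (inj₁ (refl , p)) (inj₂ (refl , ¬r)) = inj₂ (refl , ¬r ∘ snd)
holds-× pair fst snd (inj₂ (refl , ¬p)) _ = inj₂ (refl , ¬p ∘ fst)

count-∑ᴸ : ∀ (xs : List A) (P : Fin (length xs) → Bool) f →
  (∀ m → Holds (P m ≡ true) (f (lookup xs m))) → + count P ≡ ∑ᴸ xs f
count-∑ᴸ []       P f h = refl
count-∑ᴸ (x ∷ xs) P f h with P zero | h zero
... | true  | inj₁ (eq , _) = cong₂ _+ℤ_ (sym eq) (count-∑ᴸ xs (P ∘ suc) f (h ∘ suc))
... | true  | inj₂ (_ , ne) = ⊥-elim (ne refl)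
... | false | inj₂ (eq , _) = trans (count-∑ᴸ xs (P ∘ suc) f (h ∘ suc))
  (trans (sym (ℤ.+-identityˡ _)) (cong (_+ℤ ∑ᴸ xs f) (sym eq)))

holds-⌊⌋ : ∀ {P R : Set} {x} (P? : Dec P) → (P → R) → (R → P) → Holds R x → Holds (⌊ P? ⌋ ≡ true) x
holds-⌊⌋ (yes p) to from (inj₁ (eq , r))  = inj₁ (eq , refl)
holds-⌊⌋ (yes p) to from (inj₂ (eq , ¬r)) = ⊥-elim (¬r (to p))
holds-⌊⌋ (no ¬p) to from (inj₁ (eq , r))  = ⊥-elim (¬p (from r))
holds-⌊⌋ (no ¬p) to from (inj₂ (eq , ¬r)) = inj₂ (eq , λ ())

-- Interpolation of prefix tests

module Tests (p : ℕ) where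

  q : ℕ
  q = suc p

  -- Blocks are infinite, which frees `tailˢ` and `overwrite` from length bounds; only the first `r`
  -- letters enter the array.
  Stream : Set
  Stream = ℕ → Fin q

  Row : ℕ → Set
  Row = Vec Stream

  -- A test prescribes an initial segment of every block.
  Test : ℕ → Set
  Test = Vec (List (Fin q))

  cons : Fin q → Stream → Stream
  cons a y zero    = a
  cons a y (suc j) = y j

  headˢ : Stream → Fin q
  headˢ y = y 0

  tailˢ : Stream → Stream
  tailˢ y j = y (suc j)

  prefix : List (Fin q) → Stream → ℤ
  prefix []      y = 1ℤ
  prefix (a ∷ s) y = δ a (headˢ y) *ℤ prefix s (tailˢ y)

  match : ∀ {n} → Test n → Row n → ℤ
  match []      []       = 1ℤ
  match (s ∷ σ) (y ∷ ys) = prefix s y *ℤ match σ ys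

  overwrite : List (Fin q) → Stream → Stream
  overwrite []      y = y
  overwrite (a ∷ s) y = cons a (overwrite s (tailˢ y))

  over : ∀ {n} → Test n → Row n → Row n
  over []      []       = []
  over (s ∷ σ) (y ∷ ys) = overwrite s y ∷ over σ ys

  size : ∀ {n} → Test n → ℕ
  size []      = 0
  size (s ∷ σ) = length s + size σ

  push : ∀ {n} → Fin q → Test (suc n) → Test (suc n)
  push a (s ∷ σ) = (a ∷ s) ∷ σ

  SignedTest : ℕ → Set
  SignedTest n = ℤ × Test n

  keep flip : ∀ {n} → SignedTest n → SignedTest (suc n)
  keep (ε , τ) = ε , [] ∷ τ
  flip (ε , τ) = -ℤ ε , [] ∷ τ

  grow : ∀ {n} → Fin q → SignedTest (suc n) → SignedTest (suc n)
  grow a (ε , τ) = ε , push a τ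

  -- Writing b|k for the row equal to b on the first k letters of a block and to y afterwards,
  -- J encodes Σ_{k₁+…+kₙ≤t} ⊗ᵢ (bᵢ|kᵢ − bᵢ|kᵢ−1), bᵢ|−1 = 0, a signed sum of perturbations of y on which
  -- every test of size at most t takes the same value as on b.
  J : ∀ n (t : ℕ) → List (SignedTest n)
  J zero    t       = (1ℤ , []) ∷ []
  J (suc n) zero    = map keep (J n zero)
  J (suc n) (suc t) =
    map keep (J n (suc t)) ++ map flip (J n t) ++ cartesianProductWith grow (allFin q) (J (suc n) t)

  -- The kept part is the summand k₁ = 0. Prepending a letter to the family of budget `t` raises k₁
  -- by one, but turns `b|0` into `b|1` without its subtrahend `b|0`, which the flipped part
  -- supplies.
  ∑-J : ∀ n t f → ∑ᴸ (J (suc n) (suc t)) f ≡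
    ∑ᴸ (J n (suc t)) (f ∘ keep) +ℤ
    (∑ᴸ (J n t) (f ∘ flip) +ℤ ∑ᴸ (allFin q) (λ a → ∑ᴸ (J (suc n) t) (f ∘ grow a)))
  ∑-J n t f = trans (∑-++ (map keep (J n (suc t))) _ f) (cong₂ _+ℤ_ (∑-map keep (J n (suc t)) f)
    (trans (∑-++ (map flip (J n t)) _ f) (cong₂ _+ℤ_ (∑-map flip (J n t) f)
      (∑-product grow (allFin q) (J (suc n) t) f))))

  -- The factor `match τ b` discards every `τ` that disagrees with `b`; for the others `over τ y`
  -- copies `b` on the segments of `τ` and `y` elsewhere. Thus one list of tests serves all rows
  -- `b`.
  interpolate : ∀ {n} → Row n → Row n → Test n → SignedTest n → ℤ
  interpolate y b σ (ε , τ) = ε *ℤ match τ b *ℤ match σ (over τ y)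

  -- Among the prepended letters only `headˢ b₀` survives the sum. The factor `g` is what the test
  -- demands of that letter: 1 for an empty segment, `δ c` for one beginning with `c`.
  ∑-interpolate-grow : ∀ n t σ′ σ (g : Fin q → ℤ) y₀ (ys : Row n) b₀ bs →
    (∀ a j → interpolate (y₀ ∷ ys) (b₀ ∷ bs) σ′ (grow a j) ≡
      δ a (headˢ b₀) *ℤ (g a *ℤ interpolate (tailˢ y₀ ∷ ys) (tailˢ b₀ ∷ bs) σ j)) →
    ∑ᴸ (allFin q) (λ a → ∑ᴸ (J (suc n) t) (interpolate (y₀ ∷ ys) (b₀ ∷ bs) σ′ ∘ grow a)) ≡
    g (headˢ b₀) *ℤ ∑ᴸ (J (suc n) t) (interpolate (tailˢ y₀ ∷ ys) (tailˢ b₀ ∷ bs) σ)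
  ∑-interpolate-grow n t σ′ σ g y₀ ys b₀ bs eq = trans
    (∑-cong (allFin q) (λ a → trans (∑-cong (J (suc n) t) (eq a))
      (trans (∑-*ˡ (J (suc n) t) (δ a (headˢ b₀)) _)
        (cong (δ a (headˢ b₀) *ℤ_) (∑-*ˡ (J (suc n) t) (g a) _)))))
    (∑-δ (headˢ b₀) (λ a → g a *ℤ ∑ᴸ (J (suc n) t) (interpolate (tailˢ y₀ ∷ ys) (tailˢ b₀ ∷ bs) σ)))

  interpolate-grow-[] : ∀ {n} (σ : Test n) y₀ ys b₀ bs a j →
    interpolate (y₀ ∷ ys) (b₀ ∷ bs) ([] ∷ σ) (grow a j) ≡
    δ a (headˢ b₀) *ℤ (1ℤ *ℤ interpolate (tailˢ y₀ ∷ ys) (tailˢ b₀ ∷ bs) ([] ∷ σ) j)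
  interpolate-grow-[] σ y₀ ys b₀ bs a (ε , s ∷ τ) =
    rearrange ε (δ a (headˢ b₀)) (prefix s (tailˢ b₀)) (match τ bs) (1ℤ *ℤ match σ (over τ ys))
    where
    rearrange : ∀ ε d u v w → ε *ℤ (d *ℤ u *ℤ v) *ℤ w ≡ d *ℤ (1ℤ *ℤ (ε *ℤ (u *ℤ v) *ℤ w))
    rearrange = solve-∀

  interpolate-grow-∷ : ∀ {n} c r (σ : Test n) y₀ ys b₀ bs a j →
    interpolate (y₀ ∷ ys) (b₀ ∷ bs) ((c ∷ r) ∷ σ) (grow a j) ≡
    δ a (headˢ b₀) *ℤ (δ c a *ℤ interpolate (tailˢ y₀ ∷ ys) (tailˢ b₀ ∷ bs) (r ∷ σ) j)
  interpolate-grow-∷ c r σ y₀ ys b₀ bs a (ε , s ∷ τ) =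
    rearrange ε (δ a (headˢ b₀)) (prefix s (tailˢ b₀)) (match τ bs)
      (δ c a) (prefix r (overwrite s (tailˢ y₀))) (match σ (over τ ys))
    where
    rearrange : ∀ ε d u v e w x →
      ε *ℤ (d *ℤ u *ℤ v) *ℤ (e *ℤ w *ℤ x) ≡ d *ℤ (e *ℤ (ε *ℤ (u *ℤ v) *ℤ (w *ℤ x)))
    rearrange = solve-∀

  interpolate-keep : ∀ {n} s (σ : Test n) y₀ ys b₀ bs j →
    interpolate (y₀ ∷ ys) (b₀ ∷ bs) (s ∷ σ) (keep j) ≡ prefix s y₀ *ℤ interpolate ys bs σ j
  interpolate-keep s σ y₀ ys b₀ bs (ε , τ) =
    rearrange ε (match τ bs) (prefix s y₀) (match σ (over τ ys))
    where
    rearrange : ∀ ε u v w → ε *ℤ (1ℤ *ℤ u) *ℤ (v *ℤ w) ≡ v *ℤ (ε *ℤ u *ℤ w)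
    rearrange = solve-∀

  interpolate-flip : ∀ {n} s (σ : Test n) y₀ ys b₀ bs j →
    interpolate (y₀ ∷ ys) (b₀ ∷ bs) (s ∷ σ) (flip j) ≡
    -ℤ prefix s y₀ *ℤ interpolate ys bs σ j
  interpolate-flip s σ y₀ ys b₀ bs (ε , τ) =
    rearrange ε (match τ bs) (prefix s y₀) (match σ (over τ ys))
    where
    rearrange : ∀ ε u v w → -ℤ ε *ℤ (1ℤ *ℤ u) *ℤ (v *ℤ w) ≡ -ℤ v *ℤ (ε *ℤ u *ℤ w)
    rearrange = solve-∀

  ∑-keep : ∀ {n} (xs : List (SignedTest n)) s σ y₀ ys b₀ bs →
    ∑ᴸ xs (interpolate (y₀ ∷ ys) (b₀ ∷ bs) (s ∷ σ) ∘ keep) ≡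
    prefix s y₀ *ℤ ∑ᴸ xs (interpolate ys bs σ)
  ∑-keep xs s σ y₀ ys b₀ bs =
    trans (∑-cong xs (interpolate-keep s σ y₀ ys b₀ bs)) (∑-*ˡ xs (prefix s y₀) _)

  ∑-flip : ∀ {n} (xs : List (SignedTest n)) s σ y₀ ys b₀ bs →
    ∑ᴸ xs (interpolate (y₀ ∷ ys) (b₀ ∷ bs) (s ∷ σ) ∘ flip) ≡
    -ℤ prefix s y₀ *ℤ ∑ᴸ xs (interpolate ys bs σ)
  ∑-flip xs s σ y₀ ys b₀ bs =
    trans (∑-cong xs (interpolate-flip s σ y₀ ys b₀ bs)) (∑-*ˡ xs (-ℤ prefix s y₀) _)

  -- On a block where the test asks nothing, the differences `b|k − b|k−1` with k ≥ 1 evaluate to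
  -- zero; in the recursion the flipped and the grown part cancel.
  ∑-interpolate-[] : ∀ n t (σ : Test n) y₀ (ys : Row n) b₀ bs →
    ∑ᴸ (J (suc n) t) (interpolate (y₀ ∷ ys) (b₀ ∷ bs) ([] ∷ σ)) ≡
    ∑ᴸ (J n t) (interpolate ys bs σ)
  ∑-interpolate-[] n zero σ y₀ ys b₀ bs = trans (∑-map keep (J n 0) _)
    (trans (∑-keep (J n 0) [] σ y₀ ys b₀ bs) (ℤ.*-identityˡ _))
  ∑-interpolate-[] n (suc t) σ y₀ ys b₀ bs = begin
    ∑ᴸ (J (suc n) (suc t)) (interpolate (y₀ ∷ ys) (b₀ ∷ bs) ([] ∷ σ))
      ≡⟨ ∑-J n t _ ⟩
    _
      ≡⟨ cong₂ _+ℤ_ (∑-keep (J n (suc t)) [] σ y₀ ys b₀ bs)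
          (cong₂ _+ℤ_ (∑-flip (J n t) [] σ y₀ ys b₀ bs)
            (trans (∑-interpolate-grow n t ([] ∷ σ) ([] ∷ σ) (λ _ → 1ℤ) y₀ ys b₀ bs
                     (interpolate-grow-[] σ y₀ ys b₀ bs))
              (cong (1ℤ *ℤ_) (∑-interpolate-[] n t σ (tailˢ y₀) ys (tailˢ b₀) bs)))) ⟩
    1ℤ *ℤ P (suc t) +ℤ (-ℤ 1ℤ *ℤ P t +ℤ 1ℤ *ℤ P t)
      ≡⟨ cancel (P (suc t)) (P t) ⟩
    P (suc t) ∎
    where
    open ≡-Reasoning
    P : ℕ → ℤ
    P u = ∑ᴸ (J n u) (interpolate ys bs σ)
    cancel : ∀ u v → 1ℤ *ℤ u +ℤ (-ℤ 1ℤ *ℤ v +ℤ 1ℤ *ℤ v) ≡ u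
    cancel = solve-∀

  -- If the first segment is nonempty, the kept and flipped parts both evaluate the rest of `σ`
  -- exactly and so cancel, while the grown part strips the letter `c`. For `t = 0` the size bound
  -- excludes this case.
  ∑-interpolate : ∀ n t (σ : Test n) → size σ ≤ t → ∀ y b →
    ∑ᴸ (J n t) (interpolate y b σ) ≡ match σ b
  ∑-interpolate zero t [] le [] [] = refl
  ∑-interpolate (suc n) t ([] ∷ σ) le (y₀ ∷ ys) (b₀ ∷ bs) =
    trans (∑-interpolate-[] n t σ y₀ ys b₀ bs)
      (trans (∑-interpolate n t σ le ys bs) (sym (ℤ.*-identityˡ (match σ bs))))
  ∑-interpolate (suc n) (suc t) ((c ∷ r) ∷ σ) (s≤s le) (y₀ ∷ ys) (b₀ ∷ bs) = begin
    ∑ᴸ (J (suc n) (suc t)) (interpolate (y₀ ∷ ys) (b₀ ∷ bs) ((c ∷ r) ∷ σ))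
      ≡⟨ ∑-J n t _ ⟩
    _
      ≡⟨ cong₂ _+ℤ_
           (trans (∑-keep (J n (suc t)) (c ∷ r) σ y₀ ys b₀ bs)
             (cong (v *ℤ_) (∑-interpolate n (suc t) σ (ℕ.m≤n⇒m≤1+n σ≤t) ys bs)))
           (cong₂ _+ℤ_
             (trans (∑-flip (J n t) (c ∷ r) σ y₀ ys b₀ bs)
               (cong (-ℤ v *ℤ_) (∑-interpolate n t σ σ≤t ys bs)))
             (trans (∑-interpolate-grow n t ((c ∷ r) ∷ σ) (r ∷ σ) (δ c) y₀ ys b₀ bs
                      (interpolate-grow-∷ c r σ y₀ ys b₀ bs))
               (cong (δ c (headˢ b₀) *ℤ_)
                 (∑-interpolate (suc n) t (r ∷ σ) le (tailˢ y₀ ∷ ys) (tailˢ b₀ ∷ bs))))) ⟩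
    v *ℤ m +ℤ (-ℤ v *ℤ m +ℤ δ c (headˢ b₀) *ℤ (prefix r (tailˢ b₀) *ℤ m))
      ≡⟨ cancel v m (δ c (headˢ b₀)) (prefix r (tailˢ b₀)) ⟩
    δ c (headˢ b₀) *ℤ prefix r (tailˢ b₀) *ℤ m ∎
    where
    open ≡-Reasoning
    v = prefix (c ∷ r) y₀
    m = match σ bs
    σ≤t : size σ ≤ t
    σ≤t = ℕ.≤-trans (ℕ.m≤n+m (size σ) (length r)) le
    cancel : ∀ v m d u → v *ℤ m +ℤ (-ℤ v *ℤ m +ℤ d *ℤ (u *ℤ m)) ≡ d *ℤ u *ℤ m
    cancel = solve-∀

  Admissible : ∀ {n} → ℕ → SignedTest n → Set
  Admissible t (ε , τ) = ∣ ε ∣ ≡ 1 × size τ ≤ t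

  -- The size bound puts every test of `J n t` among those that `J n t` itself reproduces; signs of
  -- modulus one keep the later corrections no larger than the errors.
  J-admissible : ∀ n t → All (Admissible t) (J n t)
  J-admissible zero    t    = (refl , z≤n) ∷ []
  J-admissible (suc n) zero = All.map⁺ (J-admissible n zero)
  J-admissible (suc n) (suc t) =
    All.++⁺ (All.map⁺ (J-admissible n (suc t)))
    (All.++⁺ (All.map⁺ (All.map (λ { {ε , τ} (e , le) → trans (ℤ.∣-i∣≡∣i∣ ε) e , ℕ.m≤n⇒m≤1+n le })
                (J-admissible n t)))
      (grow-admissible (allFin q) (J-admissible (suc n) t)))
    where
    grow-admissible : ∀ as {js} → All (Admissible t) js →
      All (Admissible (suc t)) (cartesianProductWith (grow {n}) as js)
    grow-admissible []       al = []
    grow-admissible (a ∷ as) al =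
      All.++⁺ (All.map⁺ (All.map (λ { {ε , s ∷ τ} (e , le) → e , s≤s le }) al)) (grow-admissible as al)

  length-J : ∀ n t → length (J (suc n) (suc t)) ≡
    length (J n (suc t)) + (length (J n t) + q * length (J (suc n) t))
  length-J n t = trans (length-++ (map keep (J n (suc t)))) (cong₂ _+_ (length-map keep (J n (suc t)))
    (trans (length-++ (map flip (J n t))) (cong₂ _+_ (length-map flip (J n t))
      (trans (length-product grow (allFin q) (J (suc n) t))
        (cong (_* length (J (suc n) t)) (length-tabulate {n = q} (λ a → a)))))))

  -- The finite sample space of rows.

  streams : ℕ → List Stream
  streams zero    = (λ _ → zero) ∷ []
  streams (suc d) = cartesianProductWith cons (allFin q) (streams d)

  -- Each block has its own depth, so that an induction can remove a letter from the first block
  -- alone; beyond the depth all letters are `zero`.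
  rows : ∀ {n} → Vec ℕ n → List (Row n)
  rows []       = [] ∷ []
  rows (d ∷ ds) = cartesianProductWith _∷_ (streams d) (rows ds)

  Deep : ∀ {n} → ℕ → Vec ℕ n → Set
  Deep t ds = VecAll.All (t ≤_) ds

  streams-nonempty : ∀ d → 0 < length (streams d)
  streams-nonempty zero    = s≤s z≤n
  streams-nonempty (suc d) = subst (0 <_) (sym (length-product cons (allFin q) (streams d)))
    (ℕ.<-≤-trans (streams-nonempty d) (ℕ.m≤m+n _ _))

  rows-nonempty : ∀ {n} (ds : Vec ℕ n) → 0 < length (rows ds)
  rows-nonempty []       = s≤s z≤n
  rows-nonempty (d ∷ ds) = subst (0 <_) (sym (length-product _∷_ (streams d) (rows ds)))
    (ℕ.*-mono-≤ (streams-nonempty d) (rows-nonempty ds))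

  ∑-rows : ∀ {n} d (ds : Vec ℕ n) f →
    ∑ᴸ (rows (d ∷ ds)) f ≡ ∑ᴸ (streams d) (λ y → ∑ᴸ (rows ds) (λ ys → f (y ∷ ys)))
  ∑-rows d ds f = ∑-product _∷_ (streams d) (rows ds) f

  prepend : ∀ {n} → Fin q → Row (suc n) → Row (suc n)
  prepend a (y ∷ ys) = cons a y ∷ ys

  ∑-rows-suc : ∀ {n} d (ds : Vec ℕ n) f → ∑ᴸ (rows (suc d ∷ ds)) f ≡
    ∑ᴸ (allFin q) (λ a → ∑ᴸ (rows (d ∷ ds)) (f ∘ prepend a))
  ∑-rows-suc d ds f = trans (∑-rows (suc d) ds f)
    (trans (∑-product cons (allFin q) (streams d) _)
      (∑-cong (allFin q) (λ a → sym (∑-rows d ds _))))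

  -- Uniformity of random rows

  -- Since a single test fixes the letters it writes, uniformity of the perturbed row is asked only
  -- of the average over `js`; signs are ignored.
  OverUniform : ∀ {n} → List (SignedTest n) → Vec ℕ n → Set
  OverUniform js ds = ∀ g →
    ∑ᴸ js (λ j → ∑ᴸ (rows ds) (g ∘ over (proj₂ j))) ≡ + length js *ℤ ∑ᴸ (rows ds) g

  -- The first block is untouched, so its stream can be fixed and uniformity applied to the other
  -- blocks. The hypothesis on `h` covers `keep` and `flip` at once.
  map-overUniform : ∀ {n} (h : SignedTest n → SignedTest (suc n)) →
    (∀ j → proj₂ (h j) ≡ [] ∷ proj₂ j) → ∀ js d ds → OverUniform js ds → ∀ g →
    ∑ᴸ js (λ j → ∑ᴸ (rows (d ∷ ds)) (g ∘ over (proj₂ (h j)))) ≡ + length js *ℤ ∑ᴸ (rows (d ∷ ds)) g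
  map-overUniform h eq js d ds uniform g = begin
    ∑ᴸ js (λ j → ∑ᴸ (rows (d ∷ ds)) (g ∘ over (proj₂ (h j))))
      ≡⟨ ∑-cong js (λ j → trans (cong (λ τ → ∑ᴸ (rows (d ∷ ds)) (g ∘ over τ)) (eq j))
           (∑-rows d ds _)) ⟩
    ∑ᴸ js (λ j → ∑ᴸ (streams d) (λ y → ∑ᴸ (rows ds) (λ ys → g (y ∷ over (proj₂ j) ys))))
      ≡⟨ ∑-swap js (streams d) _ ⟩
    ∑ᴸ (streams d) (λ y → ∑ᴸ js (λ j → ∑ᴸ (rows ds) (λ ys → g (y ∷ over (proj₂ j) ys))))
      ≡⟨ ∑-cong (streams d) (λ y → uniform (λ ys → g (y ∷ ys))) ⟩
    ∑ᴸ (streams d) (λ y → + length js *ℤ ∑ᴸ (rows ds) (λ ys → g (y ∷ ys)))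
      ≡⟨ ∑-*ˡ (streams d) (+ length js) _ ⟩
    + length js *ℤ ∑ᴸ (streams d) (λ y → ∑ᴸ (rows ds) (λ ys → g (y ∷ ys)))
      ≡⟨ cong (+ length js *ℤ_) (sym (∑-rows d ds g)) ⟩
    + length js *ℤ ∑ᴸ (rows (d ∷ ds)) g ∎
    where open ≡-Reasoning

  over-push : ∀ {n} a b (τ : Test (suc n)) y →
    over (push a τ) (prepend b y) ≡ prepend a (over τ y)
  over-push a b (s ∷ τ) (y ∷ ys) = refl

  length-allFin : length (allFin q) ≡ q
  length-allFin = length-tabulate {n = q} (λ a → a)

  -- Overwriting discards the random first letter, which costs a factor `q`, and the written letter
  -- `a` runs over the whole alphabet in its place.
  grow-overUniform : ∀ {n} (js : List (SignedTest (suc n))) d ds → OverUniform js (d ∷ ds) → ∀ g →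
    ∑ᴸ (allFin q) (λ a → ∑ᴸ js (λ j → ∑ᴸ (rows (suc d ∷ ds)) (g ∘ over (proj₂ (grow a j))))) ≡
    + q *ℤ + length js *ℤ ∑ᴸ (rows (suc d ∷ ds)) g
  grow-overUniform js d ds uniform g = begin
    ∑ᴸ (allFin q) (λ a → ∑ᴸ js (λ j → ∑ᴸ (rows (suc d ∷ ds)) (g ∘ over (push a (proj₂ j)))))
      ≡⟨ ∑-cong (allFin q) (λ a → trans (∑-cong js (λ j → inner a j))
           (trans (∑-*ˡ js (+ q) _) (cong (+ q *ℤ_) (uniform (g ∘ prepend a))))) ⟩
    ∑ᴸ (allFin q) (λ a → + q *ℤ (+ length js *ℤ ∑ᴸ (rows (d ∷ ds)) (g ∘ prepend a)))
      ≡⟨ trans (∑-*ˡ (allFin q) (+ q) (λ a → + length js *ℤ S a)) (cong (+ q *ℤ_) (∑-*ˡ (allFin q) (+ length js) S)) ⟩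
    + q *ℤ (+ length js *ℤ ∑ᴸ (allFin q) (λ a → ∑ᴸ (rows (d ∷ ds)) (g ∘ prepend a)))
      ≡⟨ trans (sym (ℤ.*-assoc (+ q) (+ length js) _))
           (cong (+ q *ℤ + length js *ℤ_) (sym (∑-rows-suc d ds g))) ⟩
    + q *ℤ + length js *ℤ ∑ᴸ (rows (suc d ∷ ds)) g ∎
    where
    open ≡-Reasoning
    S : Fin q → ℤ
    S a = ∑ᴸ (rows (d ∷ ds)) (g ∘ prepend a)
    inner : ∀ a j → ∑ᴸ (rows (suc d ∷ ds)) (g ∘ over (push a (proj₂ j))) ≡
      + q *ℤ ∑ᴸ (rows (d ∷ ds)) (λ y → g (prepend a (over (proj₂ j) y)))
    inner a (ε , τ) = let s = ∑ᴸ (rows (d ∷ ds)) (λ y → g (prepend a (over τ y))) in trans (∑-rows-suc d ds _)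
      (trans (∑-cong (allFin q) (λ b → ∑-cong (rows (d ∷ ds)) (λ y → cong g (over-push a b τ y))))
        (trans (∑-const (allFin q) s) (cong (λ k → + k *ℤ s) length-allFin)))

  J-overUniform : ∀ n t {ds : Vec ℕ n} → Deep t ds → OverUniform (J n t) ds
  J-overUniform zero t {[]} _ g = units (g [])
    where
    units : ∀ x → (x +ℤ 0ℤ) +ℤ 0ℤ ≡ 1ℤ *ℤ (x +ℤ 0ℤ)
    units = solve-∀
  J-overUniform (suc n) zero {d ∷ ds} (_ ∷ deep) g =
    trans (∑-map keep (J n 0) _)
      (trans (map-overUniform keep (λ _ → refl) (J n 0) d ds (J-overUniform n 0 deep) g)
        (cong (λ k → + k *ℤ ∑ᴸ (rows (d ∷ ds)) g) (sym (length-map keep (J n 0)))))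
  J-overUniform (suc n) (suc t) {suc d ∷ ds} (s≤s t≤d ∷ deep) g = begin
    ∑ᴸ (J (suc n) (suc t)) (λ j → ∑ᴸ (rows (suc d ∷ ds)) (g ∘ over (proj₂ j)))
      ≡⟨ ∑-J n t _ ⟩
    _
      ≡⟨ cong₂ _+ℤ_
           (map-overUniform keep (λ _ → refl) (J n (suc t)) (suc d) ds (J-overUniform n (suc t) deep) g)
           (cong₂ _+ℤ_
             (map-overUniform flip (λ _ → refl) (J n t) (suc d) ds (J-overUniform n t deep′) g)
             (grow-overUniform (J (suc n) t) d ds (J-overUniform (suc n) t (t≤d ∷ deep′)) g)) ⟩
    + l₁ *ℤ S +ℤ (+ l₂ *ℤ S +ℤ + q *ℤ + l₃ *ℤ S)
      ≡⟨ factor (+ l₁) (+ l₂) (+ q) (+ l₃) S ⟩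
    (+ l₁ +ℤ (+ l₂ +ℤ + q *ℤ + l₃)) *ℤ S
      ≡⟨ cong (_*ℤ S) (sym (trans (cong +_ (length-J n t))
           (cong (λ k → + l₁ +ℤ (+ l₂ +ℤ k)) (ℤ.pos-* q l₃)))) ⟩
    + length (J (suc n) (suc t)) *ℤ S ∎
    where
    open ≡-Reasoning
    S = ∑ᴸ (rows (suc d ∷ ds)) g
    l₁ = length (J n (suc t))
    l₂ = length (J n t)
    l₃ = length (J (suc n) t)
    deep′ : Deep t ds
    deep′ = VecAll.map (ℕ.≤-trans (ℕ.n≤1+n t)) deep
    factor : ∀ a b c d s → a *ℤ s +ℤ (b *ℤ s +ℤ c *ℤ d *ℤ s) ≡ (a +ℤ (b +ℤ c *ℤ d)) *ℤ s
    factor = solve-∀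

  -- Each prescribed letter is an independent uniform coordinate, so a random row passes with
  -- probability one over `q ^ size σ`.
  ∑-match : ∀ {n} (σ : Test n) {ds} → Deep (size σ) ds →
    + (q ^ size σ) *ℤ ∑ᴸ (rows ds) (match σ) ≡ + length (rows ds)
  ∑-match [] {[]} _ = refl
  ∑-match ([] ∷ σ) {d ∷ ds} (_ ∷ deep) = begin
    + (q ^ size σ) *ℤ ∑ᴸ (rows (d ∷ ds)) (match ([] ∷ σ))
      ≡⟨ cong (+ (q ^ size σ) *ℤ_) (trans (∑-rows d ds _)
           (trans (∑-cong (streams d) (λ y → ∑-*ˡ (rows ds) 1ℤ (match σ)))
             (∑-const (streams d) _))) ⟩
    + (q ^ size σ) *ℤ (+ length (streams d) *ℤ (1ℤ *ℤ ∑ᴸ (rows ds) (match σ)))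
      ≡⟨ rearrange (+ (q ^ size σ)) (+ length (streams d)) _ ⟩
    + length (streams d) *ℤ (+ (q ^ size σ) *ℤ ∑ᴸ (rows ds) (match σ))
      ≡⟨ cong (+ length (streams d) *ℤ_) (∑-match σ deep) ⟩
    + length (streams d) *ℤ + length (rows ds)
      ≡⟨ trans (sym (ℤ.pos-* (length (streams d)) (length (rows ds))))
           (cong +_ (sym (length-product _∷_ (streams d) (rows ds)))) ⟩
    + length (rows (d ∷ ds)) ∎
    where
    open ≡-Reasoning
    rearrange : ∀ a b c → a *ℤ (b *ℤ (1ℤ *ℤ c)) ≡ b *ℤ (a *ℤ c)
    rearrange = solve-∀
  ∑-match ((c ∷ s) ∷ σ) {suc d ∷ ds} (s≤s le ∷ deep) = begin
    + (q * q ^ k) *ℤ ∑ᴸ (rows (suc d ∷ ds)) (match ((c ∷ s) ∷ σ))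
      ≡⟨ cong₂ _*ℤ_ (ℤ.pos-* q (q ^ k)) (trans (∑-rows-suc d ds _)
           (trans (∑-cong (allFin q) (λ b → trans (∑-cong (rows (d ∷ ds)) (split b))
               (∑-*ˡ (rows (d ∷ ds)) (δ b c) (match (s ∷ σ)))))
             (∑-δ c (λ _ → ∑ᴸ (rows (d ∷ ds)) (match (s ∷ σ)))))) ⟩
    + q *ℤ + (q ^ k) *ℤ ∑ᴸ (rows (d ∷ ds)) (match (s ∷ σ))
      ≡⟨ trans (ℤ.*-assoc (+ q) (+ (q ^ k)) (∑ᴸ (rows (d ∷ ds)) (match (s ∷ σ)))) (cong (+ q *ℤ_)
           (∑-match (s ∷ σ) (le ∷ VecAll.map (ℕ.≤-trans (ℕ.n≤1+n k)) deep))) ⟩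
    + q *ℤ + length (rows (d ∷ ds))
      ≡⟨ trans (sym (ℤ.pos-* q (length (rows (d ∷ ds))))) (cong +_ (sym (begin
           length (rows (suc d ∷ ds))
             ≡⟨ length-product _∷_ (streams (suc d)) (rows ds) ⟩
           length (streams (suc d)) * length (rows ds)
             ≡⟨ cong (_* length (rows ds)) (trans (length-product cons (allFin q) (streams d))
                  (cong (_* length (streams d)) length-allFin)) ⟩
           q * length (streams d) * length (rows ds)
             ≡⟨ trans (ℕ.*-assoc q (length (streams d)) (length (rows ds)))
                  (cong (q *_) (sym (length-product _∷_ (streams d) (rows ds)))) ⟩
           q * length (rows (d ∷ ds)) ∎))) ⟩
    + length (rows (suc d ∷ ds)) ∎
    where
    open ≡-Reasoning
    k = length s + size σ
    split : ∀ b y → match ((c ∷ s) ∷ σ) (prepend b y) ≡ δ b c *ℤ match (s ∷ σ) y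
    split b (y ∷ ys) = trans (ℤ.*-assoc (δ c b) (prefix s y) (match σ ys)) (cong (_*ℤ match (s ∷ σ) (y ∷ ys)) (δ-sym c b))

  prefix-01 : ∀ s y → prefix s y ≡ 0ℤ ⊎ prefix s y ≡ 1ℤ
  prefix-01 []      y = inj₂ refl
  prefix-01 (a ∷ s) y with δ-cases a (headˢ y)
  ... | inj₁ (eq , _) rewrite eq | ℤ.*-identityˡ (prefix s (tailˢ y)) = prefix-01 s (tailˢ y)
  ... | inj₂ (eq , _) rewrite eq = inj₁ refl

  match-01 : ∀ {n} (σ : Test n) y → match σ y ≡ 0ℤ ⊎ match σ y ≡ 1ℤ
  match-01 []      []       = inj₂ refl
  match-01 (s ∷ σ) (y ∷ ys) with prefix-01 s y
  ... | inj₁ eq rewrite eq = inj₁ refl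
  ... | inj₂ eq rewrite eq | ℤ.*-identityˡ (match σ ys) = match-01 σ ys

  -- Size of the interpolation

  length-J>0 : ∀ n t → 0 < length (J n t)
  length-J>0 zero    t       = s≤s z≤n
  length-J>0 (suc n) zero    = subst (0 <_) (sym (length-map keep (J n 0))) (length-J>0 n 0)
  length-J>0 (suc n) (suc t) = subst (0 <_) (sym (length-J n t))
    (ℕ.<-≤-trans (length-J>0 n (suc t)) (ℕ.m≤m+n _ _))

  -- Multiplying by `t !` gives the recursion for the length the shape of Bernoulli's inequality in
  -- `n + t`.
  length-J*t! : ∀ n t → length (J n t) * t ! ≤ (2 * q * (n + t)) ^ t
  length-J*t! zero t = begin
    1 * t !           ≡⟨ ℕ.*-identityˡ (t !) ⟩
    t !               ≤⟨ n!≤n^n t ⟩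
    t ^ t             ≤⟨ ℕ.^-monoˡ-≤ t (ℕ.m≤n*m t (2 * q)) ⟩
    (2 * q * t) ^ t ∎
    where open ℕ.≤-Reasoning
  length-J*t! (suc n) zero = subst (λ l → l * 1 ≤ 1) (sym (length-map keep (J n 0))) (length-J*t! n 0)
  length-J*t! (suc n) (suc t) = begin
    length (J (suc n) (suc t)) * (suc t * t !)
      ≡⟨ cong (_* (suc t * t !)) (length-J n t) ⟩
    (l₁ + (l₂ + q * l₃)) * (suc t * t !)
      ≡⟨ expand l₁ l₂ q l₃ (suc t) (t !) ⟩
    l₁ * suc t ! + suc t * (l₂ * t ! + q * (l₃ * t !))
      ≤⟨ ℕ.+-mono-≤
           (ℕ.≤-trans (length-J*t! n (suc t)) (ℕ.≤-reflexive (cong (λ k → (x * k) ^ suc t) (ℕ.+-suc n t))))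
           (ℕ.*-monoʳ-≤ (suc t) (ℕ.+-mono-≤
             (ℕ.≤-trans (length-J*t! n t) (ℕ.^-monoˡ-≤ t (ℕ.*-monoʳ-≤ x (ℕ.n≤1+n (n + t)))))
             (ℕ.*-monoʳ-≤ q (length-J*t! (suc n) t)))) ⟩
    (x * m) ^ suc t + suc t * ((x * m) ^ t + q * (x * m) ^ t)
      ≡⟨ cong₂ (λ a b → a + suc t * (b + q * b)) (^-distribʳ-* x m (suc t)) (^-distribʳ-* x m t) ⟩
    x ^ suc t * m ^ suc t + suc t * (x ^ t * m ^ t + q * (x ^ t * m ^ t))
      ≡⟨ collect (x ^ suc t) (m ^ suc t) (suc t) (x ^ t) (m ^ t) q ⟩
    x ^ suc t * m ^ suc t + (1 + q) * x ^ t * (suc t * m ^ t)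
      -- The 2 in `x = 2 * q` is spent here: `1 + q ≤ x` absorbs the flipped and the grown part
      -- together.
      ≤⟨ ℕ.+-monoʳ-≤ (x ^ suc t * m ^ suc t) (ℕ.*-monoˡ-≤ (suc t * m ^ t) (ℕ.*-monoˡ-≤ (x ^ t) 1+q≤x)) ⟩
    x ^ suc t * m ^ suc t + x ^ suc t * (suc t * m ^ t)
      ≡⟨ sym (ℕ.*-distribˡ-+ (x ^ suc t) _ _) ⟩
    x ^ suc t * (m ^ suc t + suc t * m ^ t)
      ≤⟨ ℕ.*-monoʳ-≤ (x ^ suc t) (bernoulli m t) ⟩
    x ^ suc t * suc m ^ suc t
      ≡⟨ sym (^-distribʳ-* x (suc m) (suc t)) ⟩
    (x * suc m) ^ suc t
      ≡⟨ cong (λ k → (x * suc k) ^ suc t) (sym (ℕ.+-suc n t)) ⟩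
    (x * (suc n + suc t)) ^ suc t ∎
    where
    open ℕ.≤-Reasoning
    x = 2 * q
    m = suc (n + t)
    l₁ = length (J n (suc t))
    l₂ = length (J n t)
    l₃ = length (J (suc n) t)
    1+q≤x : 1 + q ≤ x
    1+q≤x = ℕ.+-mono-≤ {1} {q} {q} (s≤s z≤n) (ℕ.m≤m+n q 0)
    expand : ∀ a b q c s f → (a + (b + q * c)) * (s * f) ≡ a * (s * f) + s * (b * f + q * (c * f))
    expand = ℕ-solve-∀
    collect : ∀ a b s c d q → a * b + s * (c * d + q * (c * d)) ≡ a * b + (1 + q) * c * (s * d)
    collect = ℕ-solve-∀

  -- Passing from `t !` to `t ^ t` costs `4 ^ t`, whence `8 = 4 * 2`.
  length-J*t^t : ∀ n t → length (J n t) * t ^ t ≤ (8 * q * (n + t)) ^ t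
  length-J*t^t n t = begin
    length (J n t) * t ^ t          ≤⟨ ℕ.*-monoʳ-≤ (length (J n t)) (n^n≤4^n*n! t) ⟩
    length (J n t) * (4 ^ t * t !)  ≡⟨ left-comm (length (J n t)) (4 ^ t) (t !) ⟩
    4 ^ t * (length (J n t) * t !)  ≤⟨ ℕ.*-monoʳ-≤ (4 ^ t) (length-J*t! n t) ⟩
    4 ^ t * (2 * q * (n + t)) ^ t   ≡⟨ sym (^-distribʳ-* 4 (2 * q * (n + t)) t) ⟩
    (4 * (2 * q * (n + t))) ^ t     ≡⟨ cong (_^ t) (assoc q (n + t)) ⟩
    (8 * q * (n + t)) ^ t ∎
    where
    open ℕ.≤-Reasoning
    left-comm : ∀ a b c → a * (b * c) ≡ b * (a * c)
    left-comm = ℕ-solve-∀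
    assoc : ∀ q m → 4 * (2 * q * m) ≡ 8 * q * m
    assoc = ℕ-solve-∀

  -- The design has `N ^ 7 * q ^ t` rows. Seven factors `N * t ^ t` and one factor `q ^ t * t ^ t`
  -- are each at most `(8 * q * (n + t)) ^ t`.
  size-bound : ∀ n t → let N = length (J n t); L = N * N * N in
    L * (L * N) * q ^ t * t ^ (8 * t) ≤ (8 * q * (n + t)) ^ (8 * t)
  size-bound n t = begin
    L * (L * N) * q ^ t * t ^ (8 * t)
      ≡⟨ cong (L * (L * N) * q ^ t *_) (trans (cong (t ^_) (ℕ.*-comm 8 t)) (sym (ℕ.^-*-assoc t t 8))) ⟩
    L * (L * N) * q ^ t * (t ^ t) ^ 8
      ≡⟨ regroup N (q ^ t) (t ^ t) ⟩
    q ^ t * t ^ t * (N * t ^ t) ^ 7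
      ≡⟨ cong (_* (N * t ^ t) ^ 7) (sym (^-distribʳ-* q t t)) ⟩
    (q * t) ^ t * (N * t ^ t) ^ 7
      ≤⟨ ℕ.*-mono-≤ (ℕ.^-monoˡ-≤ t (ℕ.*-mono-≤ (ℕ.m≤n*m q 8) (ℕ.m≤n+m t n)))
           (ℕ.^-monoˡ-≤ 7 (length-J*t^t n t)) ⟩
    ((8 * q * (n + t)) ^ t) ^ 8
      ≡⟨ trans (ℕ.^-*-assoc (8 * q * (n + t)) t 8) (cong ((8 * q * (n + t)) ^_) (ℕ.*-comm t 8)) ⟩
    (8 * q * (n + t)) ^ (8 * t) ∎
    where
    open ℕ.≤-Reasoning
    N = length (J n t)
    L = N * N * N
    regroup : ∀ N Q T → N * N * N * (N * N * N * N) * Q * (T * (T * (T * (T * (T * (T * (T * (T * 1)))))))) ≡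
      Q * T * (N * T * (N * T * (N * T * (N * T * (N * T * (N * T * (N * T * 1)))))))
    regroup = ℕ-solve-∀

  -- From lists of rows to arrays

  prefix-holds : ∀ {k} (s : Fin k → Fin q) y →
    Holds (∀ j → y (toℕ j) ≡ s j) (prefix (List.tabulate s) y)
  prefix-holds {zero}  s y = inj₁ (refl , λ ())
  prefix-holds {suc k} s y = holds-× (λ { p r zero → p ; p r (suc j) → r j }) (λ f → f zero) (λ f → f ∘ suc)
    (δ-cases (s zero) (headˢ y)) (prefix-holds (s ∘ suc) (tailˢ y))

  patternTest : ∀ {n} (ts : Fin n → ℕ) → (∀ i → Fin (ts i) → Fin q) → Test n
  patternTest ts s = Vec.tabulate (λ i → List.tabulate (s i))

  match-holds : ∀ {n} (ts : Fin n → ℕ) (s : ∀ i → Fin (ts i) → Fin q) (y : Row n) →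
    Holds (∀ i j → Vec.lookup y i (toℕ j) ≡ s i j) (match (patternTest ts s) y)
  match-holds ts s []       = inj₁ (refl , λ ())
  match-holds ts s (y ∷ ys) = holds-× (λ { p r zero → p ; p r (suc i) → r i }) (λ f → f zero) (λ f → f ∘ suc)
    (prefix-holds (s zero) y) (match-holds (ts ∘ suc) (λ i → s (suc i)) ys)

  size-patternTest : ∀ {n} (ts : Fin n → ℕ) s → size (patternTest ts s) ≡ ∑ ts
  size-patternTest {zero}  ts s = refl
  size-patternTest {suc n} ts s =
    cong₂ _+_ (length-tabulate (s zero)) (size-patternTest (ts ∘ suc) (λ i → s (suc i)))

  toArray : ∀ {n} r (xs : List (Row n)) → Array (length xs) n r q
  toArray r xs m i j = Vec.lookup (lookup xs m) i (toℕ j)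

  count-toArray : ∀ {n} r (xs : List (Row n)) ts le s →
    + count (rowMatches (toArray r xs) ts le s) ≡ ∑ᴸ xs (match (patternTest ts s))
  count-toArray r xs ts le s = count-∑ᴸ xs _ _ (λ m → holds-⌊⌋
    (all? (λ i → all? (λ j → toArray r xs m i (inject≤ j (le i)) ≟ s i j)))
    (λ f i j → trans (cong (Vec.lookup (lookup xs m) i) (sym (toℕ-inject≤ j (le i)))) (f i j))
    (λ f i j → trans (cong (Vec.lookup (lookup xs m) i) (toℕ-inject≤ j (le i))) (f i j))
    (match-holds ts s (lookup xs m)))

  -- It holds on every row, so its sum over a list counts the list.
  emptyTest : ∀ n → Test n
  emptyTest n = Vec.replicate n []

  size-emptyTest : ∀ n → size (emptyTest n) ≡ 0
  size-emptyTest zero    = refl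
  size-emptyTest (suc n) = size-emptyTest n

  match-emptyTest : ∀ {n} (y : Row n) → match (emptyTest n) y ≡ 1ℤ
  match-emptyTest []       = refl
  match-emptyTest (y ∷ ys) = trans (ℤ.*-identityˡ _) (match-emptyTest ys)

  -- The exact design

  module Design (n t : ℕ) where

    Ω : List (Row n)
    Ω = rows (Vec.replicate n t)

    K : List (SignedTest n)
    K = J n t

    -- `L` is the cube of `N` so that the second moment bound `L * N * (N * Q) ^ 2` equals
    -- `(L * Q) ^ 2`.
    N Q L : ℕ
    N = length K
    Q = q ^ t
    L = N * N * N

    -- For size at most `t` this is `Q` times the probability that a uniform row passes; the scaling
    -- keeps it integral.
    μ : Test n → ℕ
    μ σ = q ^ (t ∸ size σ)

    deep : ∀ m d {e} → e ≤ d → Deep e (Vec.replicate m d)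
    deep zero    d le = []
    deep (suc m) d le = le ∷ deep m d le

    -- Interpolation coefficients and deviations from uniformity.

    μ-mean : ∀ σ → size σ ≤ t → + length Ω *ℤ + μ σ ≡ + Q *ℤ ∑ᴸ Ω (match σ)
    μ-mean σ le = begin
      + length Ω *ℤ + μ σ
        ≡⟨ cong (_*ℤ + μ σ) (sym (∑-match σ (deep n t le))) ⟩
      + (q ^ size σ) *ℤ ∑ᴸ Ω (match σ) *ℤ + μ σ
        ≡⟨ rearrange (+ (q ^ size σ)) (∑ᴸ Ω (match σ)) (+ μ σ) ⟩
      + (q ^ size σ) *ℤ + μ σ *ℤ ∑ᴸ Ω (match σ)
        ≡⟨ cong (_*ℤ ∑ᴸ Ω (match σ)) (trans (sym (ℤ.pos-* (q ^ size σ) (μ σ)))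
             (cong +_ (trans (sym (ℕ.^-distribˡ-+-* q (size σ) (t ∸ size σ)))
               (cong (q ^_) (ℕ.m+[n∸m]≡n le))))) ⟩
      + Q *ℤ ∑ᴸ Ω (match σ) ∎
      where
      open ≡-Reasoning
      rearrange : ∀ a b c → a *ℤ b *ℤ c ≡ a *ℤ c *ℤ b
      rearrange = solve-∀

    coefficient : Row n → Test n → SignedTest n → ℤ
    coefficient y σ (ε , τ) = ε *ℤ match σ (over τ y)

    -- The interpolation identity, reordered to exhibit `match σ` as a linear combination of the
    -- tests in `K` with coefficients independent of `b`.
    ∑-coefficient-match : ∀ σ → size σ ≤ t → ∀ y b →
      ∑ᴸ K (λ j → coefficient y σ j *ℤ match (proj₂ j) b) ≡ match σ b
    ∑-coefficient-match σ le y b = trans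
      (∑-cong K (λ (ε , τ) → rearrange ε (match σ (over τ y)) (match τ b)))
      (∑-interpolate n t σ le y b)
      where
      rearrange : ∀ a b c → a *ℤ b *ℤ c ≡ a *ℤ c *ℤ b
      rearrange = solve-∀

    -- Summing the previous identity over `b` in `Ω` replaces each `match` by its mean; `length Ω`
    -- is positive and cancels.
    ∑-coefficient-μ : ∀ σ → size σ ≤ t → ∀ y →
      ∑ᴸ K (λ j → coefficient y σ j *ℤ + μ (proj₂ j)) ≡ + μ σ
    ∑-coefficient-μ σ le y =
      ℤ.*-cancelˡ-≡ (+ length Ω) _ _ {{>-nonZero (rows-nonempty (Vec.replicate n t))}} (begin
      + length Ω *ℤ ∑ᴸ K (λ j → coefficient y σ j *ℤ + μ (proj₂ j))
        ≡⟨ sym (∑-*ˡ K (+ length Ω) _) ⟩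
      ∑ᴸ K (λ j → + length Ω *ℤ (coefficient y σ j *ℤ + μ (proj₂ j)))
        ≡⟨ ∑-cong-∈ K (λ j j∈ → trans (left-comm (+ length Ω) (coefficient y σ j) (+ μ (proj₂ j)))
             (trans (cong (coefficient y σ j *ℤ_) (μ-mean (proj₂ j) (proj₂ (All.lookup (J-admissible n t) j∈))))
               (trans (left-comm (coefficient y σ j) (+ Q) (∑ᴸ Ω (match (proj₂ j))))
                 (cong (+ Q *ℤ_) (sym (∑-*ˡ Ω (coefficient y σ j) (match (proj₂ j)))))))) ⟩
      ∑ᴸ K (λ j → + Q *ℤ ∑ᴸ Ω (λ b → coefficient y σ j *ℤ match (proj₂ j) b))
        ≡⟨ trans (∑-*ˡ K (+ Q) _) (cong (+ Q *ℤ_)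
             (∑-swap K Ω (λ j b → coefficient y σ j *ℤ match (proj₂ j) b))) ⟩
      + Q *ℤ ∑ᴸ Ω (λ b → ∑ᴸ K (λ j → coefficient y σ j *ℤ match (proj₂ j) b))
        ≡⟨ cong (+ Q *ℤ_) (∑-cong Ω (∑-coefficient-match σ le y)) ⟩
      + Q *ℤ ∑ᴸ Ω (match σ)
        ≡⟨ sym (μ-mean σ le) ⟩
      + length Ω *ℤ + μ σ ∎)
      where
      open ≡-Reasoning
      left-comm : ∀ a b c → a *ℤ (b *ℤ c) ≡ b *ℤ (a *ℤ c)
      left-comm = solve-∀

    deviation : Row n → Test n → ℤ
    deviation b τ = + Q *ℤ match τ b -ℤ + μ τ

    ∑-coefficient-deviation : ∀ σ → size σ ≤ t → ∀ y b →
      ∑ᴸ K (λ j → coefficient y σ j *ℤ deviation b (proj₂ j)) ≡ deviation b σ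
    ∑-coefficient-deviation σ le y b = trans
      (∑-cong K (λ j → expand (coefficient y σ j) (+ Q) (match (proj₂ j) b) (+ μ (proj₂ j))))
      (trans (∑-- K (λ j → + Q *ℤ (coefficient y σ j *ℤ match (proj₂ j) b)) _)
        (cong₂ _-ℤ_
          (trans (∑-*ˡ K (+ Q) (λ j → coefficient y σ j *ℤ match (proj₂ j) b))
            (cong (+ Q *ℤ_) (∑-coefficient-match σ le y b)))
          (∑-coefficient-μ σ le y)))
      where
      expand : ∀ c Q m u → c *ℤ (Q *ℤ m -ℤ u) ≡ Q *ℤ (c *ℤ m) -ℤ c *ℤ u
      expand = solve-∀

    -- Choice of the sampled rows.

    total : Test n → Row n → ℤ
    total σ y = ∑ᴸ K (λ j → deviation (over (proj₂ j) y) σ)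

    total-expand : ∀ σ y →
      total σ y ≡ + Q *ℤ ∑ᴸ K (λ j → match σ (over (proj₂ j) y)) -ℤ + N *ℤ + μ σ
    total-expand σ y = trans (∑-- K (λ j → + Q *ℤ match σ (over (proj₂ j) y)) (λ _ → + μ σ))
      (cong₂ _-ℤ_ (∑-*ˡ K (+ Q) _) (∑-const K (+ μ σ)))

    -- By `J-overUniform` the perturbations of a uniform row are uniform when taken together,
    -- although one alone may be biased.
    total-mean : ∀ σ → size σ ≤ t → ∑ᴸ Ω (total σ) ≡ 0ℤ
    total-mean σ le = begin
      ∑ᴸ Ω (total σ)
        ≡⟨ trans (∑-cong Ω (total-expand σ))
             (trans (∑-- Ω (λ y → + Q *ℤ S y) (λ _ → + N *ℤ + μ σ))
               (cong₂ _-ℤ_ (∑-*ˡ Ω (+ Q) S) (∑-const Ω (+ N *ℤ + μ σ)))) ⟩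
      + Q *ℤ ∑ᴸ Ω S -ℤ + length Ω *ℤ (+ N *ℤ + μ σ)
        ≡⟨ cong (λ s → + Q *ℤ s -ℤ + length Ω *ℤ (+ N *ℤ + μ σ))
             (trans (∑-swap Ω K (λ y j → match σ (over (proj₂ j) y)))
               (J-overUniform n t (deep n t ℕ.≤-refl) (match σ))) ⟩
      + Q *ℤ (+ N *ℤ ∑ᴸ Ω (match σ)) -ℤ + length Ω *ℤ (+ N *ℤ + μ σ)
        ≡⟨ rearrange (+ Q) (+ N) (∑ᴸ Ω (match σ)) (+ length Ω) (+ μ σ) ⟩
      + N *ℤ (+ Q *ℤ ∑ᴸ Ω (match σ) -ℤ + length Ω *ℤ + μ σ)
        ≡⟨ trans (cong (+ N *ℤ_) (ℤ.i≡j⇒i-j≡0 (sym (μ-mean σ le)))) (ℤ.*-zeroʳ (+ N)) ⟩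
      0ℤ ∎
      where
      open ≡-Reasoning
      S : Row n → ℤ
      S y = ∑ᴸ K (λ j → match σ (over (proj₂ j) y))
      rearrange : ∀ Q N m l u → Q *ℤ (N *ℤ m) -ℤ l *ℤ (N *ℤ u) ≡ N *ℤ (Q *ℤ m -ℤ l *ℤ u)
      rearrange = solve-∀

    μ≤Q : ∀ σ → μ σ ≤ Q
    μ≤Q σ = ℕ.^-monoʳ-≤ q (ℕ.m∸n≤m t (size σ))

    -- Both `μ σ` and `Q` times an indicator lie between 0 and `Q`.
    ∣deviation∣≤ : ∀ b σ → ∣ deviation b σ ∣ ≤ Q
    ∣deviation∣≤ b σ with match-01 σ b
    ... | inj₁ eq rewrite eq | ℤ.*-zeroʳ (+ Q) | ℤ.+-identityˡ (-ℤ + μ σ) | ℤ.∣-i∣≡∣i∣ (+ μ σ) = μ≤Q σ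
    ... | inj₂ eq rewrite eq | ℤ.*-identityʳ (+ Q) | ℤ.m-n≡m⊖n Q (μ σ)
      | ℤ.∣m⊖n∣≡∣n⊖m∣ Q (μ σ) | ℤ.∣⊖∣-≤ (μ≤Q σ) = ℕ.m∸n≤m Q (μ σ)

    sampling : ∃ λ ys → length ys ≡ L ×
      ∑ᴸ K (λ j → ∑ᴸ ys (total (proj₂ j)) *ℤ ∑ᴸ ys (total (proj₂ j))) ≤ℤ
        + (L * (N * ((N * Q) * (N * Q))))
    sampling = small-deviations Ω K (total ∘ proj₂) (N * Q) (rows-nonempty (Vec.replicate n t))
      (λ j j∈ → total-mean (proj₂ j) (proj₂ (All.lookup (J-admissible n t) j∈)))
      (λ j _ y → ∣∑∣≤ K _ (λ i _ → ∣deviation∣≤ (over (proj₂ i) y) (proj₂ j))) L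

    ys : List (Row n)
    ys = proj₁ sampling

    error : Test n → ℤ
    error σ = ∑ᴸ ys (total σ)

    -- One square is at most the sum of the squares over `K`, and the choice of `L` makes the bound
    -- on that sum a perfect square.
    ∣error∣≤ : ∀ {j} → j ∈ K → ∣ error (proj₂ j) ∣ ≤ L * Q
    ∣error∣≤ {j} j∈ = sq-cancel-≤ (ℤ.drop‿+≤+ (begin
      + (∣ e ∣ * ∣ e ∣)               ≡⟨ sym (square e) ⟩
      e *ℤ e                          ≤⟨ term≤∑ {f = λ i → error (proj₂ i) *ℤ error (proj₂ i)}
                                           (λ i → 0≤square (error (proj₂ i))) j∈ ⟩
      ∑ᴸ K (λ i → error (proj₂ i) *ℤ error (proj₂ i))
                                      ≤⟨ proj₂ (proj₂ sampling) ⟩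
      + (L * (N * ((N * Q) * (N * Q)))) ≡⟨ cong +_ (rearrange N Q) ⟩
      + (L * Q * (L * Q)) ∎))
      where
      open ℤ.≤-Reasoning
      e = error (proj₂ j)
      0≤square : ∀ i → 0ℤ ≤ℤ i *ℤ i
      0≤square i = ℤ.≤-trans (+≤+ z≤n) (ℤ.≤-reflexive (sym (square i)))
      rearrange : ∀ N Q → N * N * N * (N * ((N * Q) * (N * Q))) ≡ N * N * N * Q * (N * N * N * Q)
      rearrange = ℕ-solve-∀

    -- A uniform weight minus a correction. At each sample the corrections sum to `error σ` on any
    -- test `σ` of size at most `t`, so all `L` samples remove `L * error σ`, exactly the excess
    -- left by the uniform weights.
    weight : SignedTest n → ℤ
    weight (ε , τ) = + (L * Q) -ℤ ε *ℤ error τ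

    0≤weight : ∀ {j} → j ∈ K → 0ℤ ≤ℤ weight j
    0≤weight {ε , τ} j∈ = ℤ.i≤j⇒0≤j-i (ℤ.≤-trans (i≤∣i∣ (ε *ℤ error τ)) (+≤+ (begin
      ∣ ε *ℤ error τ ∣   ≡⟨ ℤ.abs-* ε (error τ) ⟩
      ∣ ε ∣ * ∣ error τ ∣ ≡⟨ cong (_* ∣ error τ ∣) (proj₁ (All.lookup (J-admissible n t) j∈)) ⟩
      1 * ∣ error τ ∣    ≡⟨ ℕ.*-identityˡ _ ⟩
      ∣ error τ ∣        ≤⟨ ∣error∣≤ j∈ ⟩
      L * Q ∎)))
      where open ℕ.≤-Reasoning

    design : List (Row n)
    design = concatMap (λ y → concatMap (λ j → replicate ∣ weight j ∣ (over (proj₂ j) y)) K) ys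

    -- `error` is a sum of deviations of single rows, each reproduced by the coefficients at `y`,
    -- even when it comes from another sample `y′`.
    ∑-coefficient-error : ∀ σ → size σ ≤ t → ∀ y →
      ∑ᴸ K (λ j → coefficient y σ j *ℤ error (proj₂ j)) ≡ error σ
    ∑-coefficient-error σ le y = begin
      ∑ᴸ K (λ j → c j *ℤ error (proj₂ j))
        ≡⟨ ∑-cong K (λ j → trans (sym (∑-*ˡ ys (c j) (total (proj₂ j))))
             (∑-cong ys (λ y′ → sym (∑-*ˡ K (c j) _)))) ⟩
      ∑ᴸ K (λ j → ∑ᴸ ys (λ y′ → ∑ᴸ K (λ i → c j *ℤ deviation (over (proj₂ i) y′) (proj₂ j))))
        ≡⟨ ∑-swap K ys _ ⟩
      ∑ᴸ ys (λ y′ → ∑ᴸ K (λ j → ∑ᴸ K (λ i → c j *ℤ deviation (over (proj₂ i) y′) (proj₂ j))))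
        ≡⟨ ∑-cong ys (λ y′ → trans (∑-swap K K _)
             (∑-cong K (λ i → ∑-coefficient-deviation σ le y (over (proj₂ i) y′)))) ⟩
      error σ ∎
      where
      open ≡-Reasoning
      c = coefficient y σ

    ∑-design : ∀ σ → size σ ≤ t → ∑ᴸ design (match σ) ≡ + (L * (L * N) * μ σ)
    ∑-design σ le = begin
      ∑ᴸ design (match σ)
        ≡⟨ trans (∑-concatMap _ ys (match σ)) (∑-cong ys (λ y → trans (∑-concatMap _ K (match σ))
             (∑-cong-∈ K (λ j j∈ → trans (∑-replicate ∣ weight j ∣ _ (match σ))
               (cong (_*ℤ match σ (over (proj₂ j) y)) (ℤ.0≤i⇒+∣i∣≡i (0≤weight j∈))))))) ⟩
      ∑ᴸ ys (λ y → ∑ᴸ K (λ j → weight j *ℤ match σ (over (proj₂ j) y)))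
        ≡⟨ ∑-cong ys (λ y → trans
             (∑-cong K (λ (ε , τ) → expand (+ (L * Q)) ε (error τ) (match σ (over τ y))))
             (trans (∑-- K (λ j → + (L * Q) *ℤ match σ (over (proj₂ j) y)) _)
               (cong₂ _-ℤ_ (∑-*ˡ K (+ (L * Q)) _) (∑-coefficient-error σ le y)))) ⟩
      ∑ᴸ ys (λ y → + (L * Q) *ℤ S y -ℤ error σ)
        ≡⟨ trans (∑-- ys (λ y → + (L * Q) *ℤ S y) (λ _ → error σ))
             (cong₂ _-ℤ_ (∑-*ˡ ys (+ (L * Q)) S) (trans (∑-const ys (error σ))
               (cong (λ l → + l *ℤ error σ) ys-length))) ⟩
      + (L * Q) *ℤ ∑ᴸ ys S -ℤ + L *ℤ error σ
        -- Once the error is expanded, the terms in `∑ᴸ ys S` cancel and only a multiple of `μ σ`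
        -- remains.
        ≡⟨ cong (λ e → + (L * Q) *ℤ ∑ᴸ ys S -ℤ + L *ℤ e) error-expand ⟩
      + (L * Q) *ℤ ∑ᴸ ys S -ℤ + L *ℤ (+ Q *ℤ ∑ᴸ ys S -ℤ + L *ℤ (+ N *ℤ + μ σ))
        ≡⟨ cong (λ x → x *ℤ ∑ᴸ ys S -ℤ + L *ℤ (+ Q *ℤ ∑ᴸ ys S -ℤ + L *ℤ (+ N *ℤ + μ σ))) (ℤ.pos-* L Q) ⟩
      + L *ℤ + Q *ℤ ∑ᴸ ys S -ℤ + L *ℤ (+ Q *ℤ ∑ᴸ ys S -ℤ + L *ℤ (+ N *ℤ + μ σ))
        ≡⟨ cancel (+ L) (+ Q) (∑ᴸ ys S) (+ N) (+ μ σ) ⟩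
      + L *ℤ (+ L *ℤ + N) *ℤ + μ σ
        ≡⟨ sym (trans (ℤ.pos-* (L * (L * N)) (μ σ)) (cong (_*ℤ + μ σ)
             (trans (ℤ.pos-* L (L * N)) (cong (+ L *ℤ_) (ℤ.pos-* L N))))) ⟩
      + (L * (L * N) * μ σ) ∎
      where
      open ≡-Reasoning
      S : Row n → ℤ
      S y = ∑ᴸ K (λ j → match σ (over (proj₂ j) y))
      ys-length : length ys ≡ L
      ys-length = proj₁ (proj₂ sampling)
      error-expand : error σ ≡ + Q *ℤ ∑ᴸ ys S -ℤ + L *ℤ (+ N *ℤ + μ σ)
      error-expand = trans (∑-cong ys (total-expand σ))
        (trans (∑-- ys (λ y → + Q *ℤ S y) (λ _ → + N *ℤ + μ σ))
          (cong₂ _-ℤ_ (∑-*ˡ ys (+ Q) S) (trans (∑-const ys (+ N *ℤ + μ σ))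
            (cong (λ l → + l *ℤ (+ N *ℤ + μ σ)) ys-length))))
      expand : ∀ l ε e m → (l -ℤ ε *ℤ e) *ℤ m ≡ l *ℤ m -ℤ ε *ℤ m *ℤ e
      expand = solve-∀
      cancel : ∀ L Q S N u → L *ℤ Q *ℤ S -ℤ L *ℤ (Q *ℤ S -ℤ L *ℤ (N *ℤ u)) ≡ L *ℤ (L *ℤ N) *ℤ u
      cancel = solve-∀

-- Reading the array off the design.

theorem1p1 : Σ ℕ λ c → 1 ≤ c ×
    ((q n r t : ℕ) → 2 ≤ q → 1 ≤ n → 1 ≤ r → 1 ≤ t → t ≤ n * r →
    Σ ℕ λ lam → Σ ℕ λ M → Σ (Array M n r q) λ Y →
    1 ≤ lam × IsOOA t q n r lam M Y ×
    M * t ^ (c * t) ≤ (c * q * (n + t)) ^ (c * t))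
theorem1p1 = 8 , s≤s z≤n , construct
  where
  construct : (q n r t : ℕ) → 2 ≤ q → 1 ≤ n → 1 ≤ r → 1 ≤ t → t ≤ n * r →
    Σ ℕ λ lam → Σ ℕ λ M → Σ (Array M n r q) λ Y →
    1 ≤ lam × IsOOA t q n r lam M Y ×
    M * t ^ (8 * t) ≤ (8 * q * (n + t)) ^ (8 * t)
  construct (suc p) n r t _ _ _ _ _ =
    lam , length design , toArray r design , lam≥1 , isOOA ,
    subst (λ M → M * t ^ (8 * t) ≤ (8 * suc p * (n + t)) ^ (8 * t)) (sym length-design) (size-bound n t)
    where
    open Tests p
    open Design n t
    lam : ℕ
    lam = L * (L * N)
    N≥1 : 1 ≤ N
    N≥1 = length-J>0 n t
    L≥1 : 1 ≤ L
    L≥1 = ℕ.*-mono-≤ (ℕ.*-mono-≤ N≥1 N≥1) N≥1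
    lam≥1 : 1 ≤ lam
    lam≥1 = ℕ.*-mono-≤ L≥1 (ℕ.*-mono-≤ L≥1 N≥1)
    isOOA : IsOOA t (suc p) n r lam (length design) (toArray r design)
    isOOA ts le eq s = ℤ.+-injective (trans (count-toArray r design ts le s)
      (trans (∑-design (patternTest ts s) (ℕ.≤-reflexive size≡t))
        -- At size exactly `t` the exponent in `μ` is zero, so the pattern occurs `lam` times.
        (cong +_ (trans (cong (λ k → lam * suc p ^ (t ∸ k)) size≡t)
          (trans (cong (λ k → lam * suc p ^ k) (ℕ.n∸n≡0 t)) (ℕ.*-identityʳ lam))))))
      where
      size≡t : size (patternTest ts s) ≡ t
      size≡t = trans (size-patternTest ts s) eq
    length-design : length design ≡ lam * suc p ^ t
    length-design = ℤ.+-injective (trans (sym (trans (∑-const design 1ℤ) (ℤ.*-identityʳ _)))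
      (trans (sym (∑-cong design match-emptyTest))
        (trans (∑-design (emptyTest n) (subst (_≤ t) (sym (size-emptyTest n)) z≤n))
          (cong (λ k → + (lam * suc p ^ (t ∸ k))) (size-emptyTest n)))))
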